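{- Let $\mathbb{P}$ be the set of all process terms. Let $$\mathfrak{U} = \{P \in \mathbb{P} \mid \exists\, \Gamma, \Delta, \Lambda \text{ such that } \Gamma; \Delta \vdash P :: \Lambda\}$$ be the set of processes typable in the two-sided type system $\pi\mathsf{ULL}$, and let $$\mathfrak{C} = \{P \in \mathbb{P} \mid \exists\, \Gamma, \Delta \text{ such that } P \vdash_{\mathsf{CLL}} \Gamma; \Delta\}$$ be the set of processes typable in the one-sided classical type system $\pi\mathsf{CLL}^{\mathsf{CP}}$. Then $\mathfrak{U} = \mathfrak{C}$.
   Context: **Types.** $A,B ::= \mathbf{1} \mid \bot \mid A \otimes B \mid A ⅋ B \mid A \multimap B \mid\ !A \mid\ ?A$ (no atoms). Duality: $\mathbf{1}^\perp=\bot$, $\bot^\perp=\mathbf{1}$, $(A\otimes B)^\perp = A^\perp ⅋ B^\perp$, $(A ⅋ B)^\perp = A^\perp\otimes B^\perp$, $(!A)^\perp = {?}A^\perp$, $(?A)^\perp = {!}A^\perp$. By decree $A\multimap B = A^\perp ⅋ B$ (these are identified). Duality is an involution. **Processes.** $P,Q ::= \mathbf{0} \mid [x\leftrightarrow y] \mid (\nu x)P \mid P|Q \mid x\langle y\rangle.P \mid x(y).P \mid\ !x(y).P \mid x\langle\rangle.\mathbf{0} \mid x().P$. The constructs $(\nu x)P$, $z(x).P$, $!z(x).P$ bind $x$ in $P$; the output $x\langle y\rangle.P$ binds nothing. $P\{y/x\}$ is capture-avoiding substitution of $y$ for free $x$. Terms are taken up to $\alpha$-conversion. **Contexts.** $\Gamma,\Delta,\Lambda$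 are finite unordered collections of assignments $x:A$ with pairwise distinct names; a comma denotes disjoint union, $\cdot$ is empty. $\Gamma$ is unrestricted, the others are linear. **System $\pi\mathsf{ULL}$** (judgments $\Gamma;\Delta\vdash P::\Lambda$; premises $\Rightarrow$ conclusion; primed contexts are arbitrary): - Id R: $\Gamma; x:A \vdash [x\leftrightarrow y] :: y:A$. - Id L: $\Gamma; x:A, y:A^\perp \vdash [x\leftrightarrow y] :: \cdot$. - Cut R: $\Gamma;\Delta\vdash P::\Lambda,x:A$ and $\Gamma;\Delta',x:A\vdash Q::\Lambda'$ $\Rightarrow$ $\Gamma;\Delta,\Delta'\vdash(\nu x)(P|Q)::\Lambda,\Lambda'$. - Cut L: $\Gamma;\Delta,x:A\vdash P::\Lambda$ and $\Gamma;\Delta',x:A^\perp\vdash Q::\Lambda'$ $\Rightarrow$ $\Gamma;\Delta,\Delta'\vdash(\nu x)(P|Q)::\Lambda,\Lambda'$. - Cut! R: $\Gamma;\cdot\vdash P::y:A$ and $\Gamma,u:A;\Delta\vdash Q::\Lambda$ $\Rightarrow$ $\Gamma;\Delta\vdash(\nu u)(!u(y).P\,|\,Q)::\Lambda$. - Cut! L: $\Gamma;y:A^\perp\vdash P::\cdot$ and $\Gamma,u:A;\Delta\vdash Q::\Lambda$ $\Rightarrow$ $\Gamma;\Delta\vdash(\nu u)(!u(y).P\,|\,Q)::\Lambda$. - Copy L: $\Gamma,u:A;\Delta,y:A\vdash P::\Lambda$ $\Rightarrow$ $\Gamma,u:A;\Delta\vdash(\nu y)u\langle y\rangle.P::\Lambda$.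 - Copy R: $\Gamma,u:A;\Delta\vdash P::\Lambda,y:A^\perp$ $\Rightarrow$ $\Gamma,u:A;\Delta\vdash(\nu y)u\langle y\rangle.P::\Lambda$. - $\mathbf 1$R: $\Gamma;\cdot\vdash x\langle\rangle.\mathbf 0::x:\mathbf 1$. - $\mathbf 1$L: $\Gamma;\Delta\vdash P::\Lambda$ $\Rightarrow$ $\Gamma;\Delta,x:\mathbf 1\vdash x().P::\Lambda$. - $\bot$R: $\Gamma;\Delta\vdash P::\Lambda$ $\Rightarrow$ $\Gamma;\Delta\vdash x().P::\Lambda,x:\bot$. - $\bot$L: $\Gamma;x:\bot\vdash x\langle\rangle.\mathbf 0::\cdot$. - $\otimes$R: $\Gamma;\Delta\vdash P::\Lambda,y:A$ and $\Gamma;\Delta'\vdash Q::\Lambda',x:B$ $\Rightarrow$ $\Gamma;\Delta,\Delta'\vdash(\nu y)x\langle y\rangle.(P|Q)::\Lambda,\Lambda',x:A\otimes B$. - $\otimes$L: $\Gamma;\Delta,y:A,x:B\vdash P::\Lambda$ $\Rightarrow$ $\Gamma;\Delta,x:A\otimes B\vdash x(y).P::\Lambda$. - $⅋$R: $\Gamma;\Delta\vdash P::\Lambda,y:A,x:B$ $\Rightarrow$ $\Gamma;\Delta\vdash x(y).P::\Lambda,x:A⅋B$. - $⅋$L: $\Gamma;\Delta,y:A\vdash P::\Lambda$ and $\Gamma;\Delta',x:B\vdash Q::\Lambda'$ $\Rightarrow$ $\Gamma;\Delta,\Delta',x:A⅋B\vdash(\nu y)x\langle y\rangle.(P|Q)::\Lambda,\Lambda'$.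 - $\multimap$R: $\Gamma;\Delta,y:A\vdash P::\Lambda,x:B$ $\Rightarrow$ $\Gamma;\Delta\vdash x(y).P::\Lambda,x:A\multimap B$. - $\multimap$L: $\Gamma;\Delta\vdash P::\Lambda,y:A$ and $\Gamma;\Delta',x:B\vdash Q::\Lambda'$ $\Rightarrow$ $\Gamma;\Delta,\Delta',x:A\multimap B\vdash(\nu y)x\langle y\rangle.(P|Q)::\Lambda,\Lambda'$. - $!$R: $\Gamma;\cdot\vdash P::y:A$ $\Rightarrow$ $\Gamma;\cdot\vdash\ !x(y).P::x:{!}A$. - $!$L: $\Gamma,u:A;\Delta\vdash P::\Lambda$ $\Rightarrow$ $\Gamma;\Delta,x:{!}A\vdash P\{x/u\}::\Lambda$. - $?$R: $\Gamma,u:A;\Delta\vdash P::\Lambda$ $\Rightarrow$ $\Gamma;\Delta\vdash P\{x/u\}::\Lambda,x:{?}A^\perp$. - $?$L: $\Gamma;y:A\vdash P::\cdot$ $\Rightarrow$ $\Gamma;x:{?}A\vdash\ !x(y).P::\cdot$. **System $\pi\mathsf{CLL}^{\mathsf{CP}}$** (judgments $P\vdash_{\mathsf{CLL}}\Gamma;\Delta$, with $\Gamma$ unrestricted and $\Delta$ linear; write $\vdash$ for $\vdash_{\mathsf{CLL}}$): - Id: $[x\leftrightarrow y]\vdash\Gamma;x:A,y:A^\perp$. - Cut: $P\vdash\Gamma;\Delta,x:A$ and $Q\vdash\Gamma;\Delta',x:A^\perp$ $\Rightarrow$ $(\nu x)(P|Q)\vdash\Gamma;\Delta,\Delta'$.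 - Cut!: $P\vdash\Gamma;y:A$ and $Q\vdash\Gamma,u:A^\perp;\Delta$ $\Rightarrow$ $(\nu u)(!u(y).P\,|\,Q)\vdash\Gamma;\Delta$. - Copy: $P\vdash\Gamma,u:A;\Delta,y:A$ $\Rightarrow$ $(\nu y)u\langle y\rangle.P\vdash\Gamma,u:A;\Delta$. - $\mathbf 1$: $x\langle\rangle.\mathbf 0\vdash\Gamma;x:\mathbf 1$. - $\bot$: $P\vdash\Gamma;\Delta$ $\Rightarrow$ $x().P\vdash\Gamma;\Delta,x:\bot$. - $\otimes$: $P\vdash\Gamma;\Delta,y:A$ and $Q\vdash\Gamma;\Delta',x:B$ $\Rightarrow$ $(\nu y)x\langle y\rangle.(P|Q)\vdash\Gamma;\Delta,\Delta',x:A\otimes B$. - $⅋$: $P\vdash\Gamma;\Delta,y:A,x:B$ $\Rightarrow$ $x(y).P\vdash\Gamma;\Delta,x:A⅋B$. - $!$: $P\vdash\Gamma;y:A$ $\Rightarrow$ $!x(y).P\vdash\Gamma;x:{!}A$. - $?$: $P\vdash\Gamma,u:A;\Delta$ $\Rightarrow$ $P\{x/u\}\vdash\Gamma;\Delta,x:{?}A$. -}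

module Defs where

open import Data.Fin using (Fin; zero; suc)
open import Data.List using (List; []; _∷_; _++_; map)
open import Data.List.Membership.Propositional using (_∉_)
open import Data.List.Relation.Binary.Permutation.Propositional using (_↭_)
open import Data.List.Relation.Unary.Unique.Propositional using (Unique)
open import Data.Nat using (ℕ; zero; suc; _≟_)
open import Data.Product using (∃-syntax)
open import Level using (0ℓ)
open import Relation.Nullary using (yes; no)
open import Relation.Unary using (Pred)

infix  9 _^⊥
infix  8 !_ ⁇_
infixr 7 _⊗_ _⅋_ _⊸_
infix  6 _∶_
infixr 5 _∣_
infix  5 ⦅ν_⦆_ _⟨_⟩∙_ _⦅_⦆∙_ ‼_⦅_⦆∙_ _⟨⟩∙𝟎 _⦅⦆∙_
infix  6 _⟦_/_⟧
infix  3 _⨾_⊢_::_ _⊢ᶜ_⨾_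

data Type : Set where
  𝟏 ⊥     : Type
  _⊗_ _⅋_ : Type → Type → Type
  !_ ⁇_   : Type → Type

_^⊥ : Type → Type
𝟏 ^⊥       = ⊥
⊥ ^⊥       = 𝟏
(A ⊗ B) ^⊥ = A ^⊥ ⅋ B ^⊥
(A ⅋ B) ^⊥ = A ^⊥ ⊗ B ^⊥
(! A) ^⊥   = ⁇ (A ^⊥)
(⁇ A) ^⊥   = ! (A ^⊥)

-- A ⊸ B and A ^⊥ ⅋ B are the same type, so ⊸ is not a constructor.
_⊸_ : Type → Type → Type
A ⊸ B = A ^⊥ ⅋ B

Name : Set
Name = ℕ

-- Well-scoped locally nameless syntax: free names are kept, and an occurrence
-- of a bound name is the de Bruijn index of its binder, so that α-equivalent
-- terms are equal.  Raw n has n enclosing binders.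
data Ref (n : ℕ) : Set where
  free  : Name → Ref n
  bound : Fin n → Ref n

data Raw (n : ℕ) : Set where
  𝟎    : Raw n
  fwd  : Ref n → Ref n → Raw n           -- [x↔y]
  res  : Raw (suc n) → Raw n             -- (νx)P
  _∣_  : Raw n → Raw n → Raw n
  out  : Ref n → Ref n → Raw n → Raw n   -- x⟨y⟩.P, not binding y
  inp  : Ref n → Raw (suc n) → Raw n     -- x(y).P
  serv : Ref n → Raw (suc n) → Raw n     -- !x(y).P
  emp  : Ref n → Raw n                   -- x⟨⟩.𝟎
  wait : Ref n → Raw n → Raw n           -- x().P

Process : Set
Process = Raw 0

shift : ∀ {n} → Ref n → Ref (suc n)
shift (free x)  = free x
shift (bound i) = bound (suc i)

lift : ∀ {m n} → (Ref m → Ref n) → Ref (suc m) → Ref (suc n)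
lift ρ (free x)        = shift (ρ (free x))
lift ρ (bound zero)    = bound zero
lift ρ (bound (suc i)) = shift (ρ (bound i))

rename : ∀ {m n} → (Ref m → Ref n) → Raw m → Raw n
rename ρ 𝟎           = 𝟎
rename ρ (fwd a b)   = fwd (ρ a) (ρ b)
rename ρ (res P)     = res (rename (lift ρ) P)
rename ρ (P ∣ Q)     = rename ρ P ∣ rename ρ Q
rename ρ (out a b P) = out (ρ a) (ρ b) (rename ρ P)
rename ρ (inp a P)   = inp (ρ a) (rename (lift ρ) P)
rename ρ (serv a P)  = serv (ρ a) (rename (lift ρ) P)
rename ρ (emp a)     = emp (ρ a)
rename ρ (wait a P)  = wait (ρ a) (rename ρ P)

-- Turns the free occurrences of x into references to a new outermost binder.
bindRef : Name → Ref 0 → Ref 1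
bindRef x (free z) with z ≟ x
... | yes _ = bound zero
... | no  _ = free z

bind : Name → Process → Raw 1
bind x = rename (bindRef x)

substRef : Name → Name → Ref 0 → Ref 0
substRef y x (free z) with z ≟ x
... | yes _ = free y
... | no  _ = free z

-- P ⟦ y / x ⟧ replaces free x by y; free names cannot be captured.
_⟦_/_⟧ : Process → Name → Name → Process
P ⟦ y / x ⟧ = rename (substRef y x) P

-- Named notation: a binder abstracts its name from its body.  Replicated input
-- !x(y).P is written ‼ x ⦅ y ⦆∙ P, as ! is taken by the type.

[_↔_] : Name → Name → Process
[ x ↔ y ] = fwd (free x) (free y)

⦅ν_⦆_ : Name → Process → Process
⦅ν x ⦆ P = res (bind x P)

_⟨_⟩∙_ : Name → Name → Process → Process
x ⟨ y ⟩∙ P = out (free x) (free y) P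

_⦅_⦆∙_ : Name → Name → Process → Process
x ⦅ y ⦆∙ P = inp (free x) (bind y P)

‼_⦅_⦆∙_ : Name → Name → Process → Process
‼ x ⦅ y ⦆∙ P = serv (free x) (bind y P)

_⟨⟩∙𝟎 : Name → Process
x ⟨⟩∙𝟎 = emp (free x)

_⦅⦆∙_ : Name → Process → Process
x ⦅⦆∙ P = wait (free x) P

record Assignment : Set where
  constructor _∶_
  field
    name : Name
    type : Type

open Assignment public

-- Contexts are unordered: lists, with an exchange rule in each system.
Ctx : Set
Ctx = List Assignment

dom : Ctx → List Name
dom = map name

-- The names of a judgment are pairwise distinct across all its zones; every
-- rule requires this of its conclusion.  (If Δ and Λ could share names, Id R
-- would type [x↔x], which the one-sided Id cannot.)
Distinct : Ctx → Set
Distinct Γ = Unique (dom Γ)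

private variable
  Γ Γ′ Δ Δ′ Λ Λ′ : Ctx
  P Q            : Process
  A B            : Type
  x y u          : Name

-- In the rules whose process is (νy)x⟨y⟩.(P|Q), y must moreover be fresh for
-- the conclusion, so that νy captures neither the subject x nor a name of Q.
-- In the other rules no such capture can arise.
data _⨾_⊢_::_ : Ctx → Ctx → Process → Ctx → Set where

  exch : Γ ↭ Γ′ → Δ ↭ Δ′ → Λ ↭ Λ′ →
         Γ ⨾ Δ ⊢ P :: Λ →
         Γ′ ⨾ Δ′ ⊢ P :: Λ′

  idR : Distinct (Γ ++ (x ∶ A ∷ []) ++ (y ∶ A ∷ [])) →
        Γ ⨾ x ∶ A ∷ [] ⊢ [ x ↔ y ] :: y ∶ A ∷ []

  idL : Distinct (Γ ++ (x ∶ A ∷ y ∶ A ^⊥ ∷ []) ++ []) →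
        Γ ⨾ x ∶ A ∷ y ∶ A ^⊥ ∷ [] ⊢ [ x ↔ y ] :: []

  cutR : Distinct (Γ ++ (Δ ++ Δ′) ++ (Λ ++ Λ′)) →
         Γ ⨾ Δ ⊢ P :: x ∶ A ∷ Λ →
         Γ ⨾ x ∶ A ∷ Δ′ ⊢ Q :: Λ′ →
         Γ ⨾ Δ ++ Δ′ ⊢ ⦅ν x ⦆ (P ∣ Q) :: Λ ++ Λ′

  cutL : Distinct (Γ ++ (Δ ++ Δ′) ++ (Λ ++ Λ′)) →
         Γ ⨾ x ∶ A ∷ Δ ⊢ P :: Λ →
         Γ ⨾ x ∶ A ^⊥ ∷ Δ′ ⊢ Q :: Λ′ →
         Γ ⨾ Δ ++ Δ′ ⊢ ⦅ν x ⦆ (P ∣ Q) :: Λ ++ Λ′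

  cut!R : Distinct (Γ ++ Δ ++ Λ) →
          Γ ⨾ [] ⊢ P :: y ∶ A ∷ [] →
          u ∶ A ∷ Γ ⨾ Δ ⊢ Q :: Λ →
          Γ ⨾ Δ ⊢ ⦅ν u ⦆ ((‼ u ⦅ y ⦆∙ P) ∣ Q) :: Λ

  cut!L : Distinct (Γ ++ Δ ++ Λ) →
          Γ ⨾ y ∶ A ^⊥ ∷ [] ⊢ P :: [] →
          u ∶ A ∷ Γ ⨾ Δ ⊢ Q :: Λ →
          Γ ⨾ Δ ⊢ ⦅ν u ⦆ ((‼ u ⦅ y ⦆∙ P) ∣ Q) :: Λ

  copyL : Distinct ((u ∶ A ∷ Γ) ++ Δ ++ Λ) →
          u ∶ A ∷ Γ ⨾ y ∶ A ∷ Δ ⊢ P :: Λ →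
          u ∶ A ∷ Γ ⨾ Δ ⊢ ⦅ν y ⦆ (u ⟨ y ⟩∙ P) :: Λ

  copyR : Distinct ((u ∶ A ∷ Γ) ++ Δ ++ Λ) →
          u ∶ A ∷ Γ ⨾ Δ ⊢ P :: y ∶ A ^⊥ ∷ Λ →
          u ∶ A ∷ Γ ⨾ Δ ⊢ ⦅ν y ⦆ (u ⟨ y ⟩∙ P) :: Λ

  𝟏R : Distinct (Γ ++ [] ++ (x ∶ 𝟏 ∷ [])) →
       Γ ⨾ [] ⊢ x ⟨⟩∙𝟎 :: x ∶ 𝟏 ∷ []

  𝟏L : Distinct (Γ ++ (x ∶ 𝟏 ∷ Δ) ++ Λ) →
       Γ ⨾ Δ ⊢ P :: Λ →
       Γ ⨾ x ∶ 𝟏 ∷ Δ ⊢ x ⦅⦆∙ P :: Λ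

  ⊥R : Distinct (Γ ++ Δ ++ (x ∶ ⊥ ∷ Λ)) →
       Γ ⨾ Δ ⊢ P :: Λ →
       Γ ⨾ Δ ⊢ x ⦅⦆∙ P :: x ∶ ⊥ ∷ Λ

  ⊥L : Distinct (Γ ++ (x ∶ ⊥ ∷ []) ++ []) →
       Γ ⨾ x ∶ ⊥ ∷ [] ⊢ x ⟨⟩∙𝟎 :: []

  ⊗R : Distinct (Γ ++ (Δ ++ Δ′) ++ (x ∶ A ⊗ B ∷ Λ ++ Λ′)) →
       y ∉ dom (Γ ++ (Δ ++ Δ′) ++ (x ∶ A ⊗ B ∷ Λ ++ Λ′)) →
       Γ ⨾ Δ ⊢ P :: y ∶ A ∷ Λ →
       Γ ⨾ Δ′ ⊢ Q :: x ∶ B ∷ Λ′ →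
       Γ ⨾ Δ ++ Δ′ ⊢ ⦅ν y ⦆ (x ⟨ y ⟩∙ (P ∣ Q)) :: x ∶ A ⊗ B ∷ Λ ++ Λ′

  ⊗L : Distinct (Γ ++ (x ∶ A ⊗ B ∷ Δ) ++ Λ) →
       Γ ⨾ y ∶ A ∷ x ∶ B ∷ Δ ⊢ P :: Λ →
       Γ ⨾ x ∶ A ⊗ B ∷ Δ ⊢ x ⦅ y ⦆∙ P :: Λ

  ⅋R : Distinct (Γ ++ Δ ++ (x ∶ A ⅋ B ∷ Λ)) →
       Γ ⨾ Δ ⊢ P :: y ∶ A ∷ x ∶ B ∷ Λ →
       Γ ⨾ Δ ⊢ x ⦅ y ⦆∙ P :: x ∶ A ⅋ B ∷ Λ

  ⅋L : Distinct (Γ ++ (x ∶ A ⅋ B ∷ Δ ++ Δ′) ++ (Λ ++ Λ′)) →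
       y ∉ dom (Γ ++ (x ∶ A ⅋ B ∷ Δ ++ Δ′) ++ (Λ ++ Λ′)) →
       Γ ⨾ y ∶ A ∷ Δ ⊢ P :: Λ →
       Γ ⨾ x ∶ B ∷ Δ′ ⊢ Q :: Λ′ →
       Γ ⨾ x ∶ A ⅋ B ∷ Δ ++ Δ′ ⊢ ⦅ν y ⦆ (x ⟨ y ⟩∙ (P ∣ Q)) :: Λ ++ Λ′

  ⊸R : Distinct (Γ ++ Δ ++ (x ∶ A ⊸ B ∷ Λ)) →
       Γ ⨾ y ∶ A ∷ Δ ⊢ P :: x ∶ B ∷ Λ →
       Γ ⨾ Δ ⊢ x ⦅ y ⦆∙ P :: x ∶ A ⊸ B ∷ Λ

  ⊸L : Distinct (Γ ++ (x ∶ A ⊸ B ∷ Δ ++ Δ′) ++ (Λ ++ Λ′)) →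
       y ∉ dom (Γ ++ (x ∶ A ⊸ B ∷ Δ ++ Δ′) ++ (Λ ++ Λ′)) →
       Γ ⨾ Δ ⊢ P :: y ∶ A ∷ Λ →
       Γ ⨾ x ∶ B ∷ Δ′ ⊢ Q :: Λ′ →
       Γ ⨾ x ∶ A ⊸ B ∷ Δ ++ Δ′ ⊢ ⦅ν y ⦆ (x ⟨ y ⟩∙ (P ∣ Q)) :: Λ ++ Λ′

  !R : Distinct (Γ ++ [] ++ (x ∶ ! A ∷ [])) →
       Γ ⨾ [] ⊢ P :: y ∶ A ∷ [] →
       Γ ⨾ [] ⊢ ‼ x ⦅ y ⦆∙ P :: x ∶ ! A ∷ []

  !L : Distinct (Γ ++ (x ∶ ! A ∷ Δ) ++ Λ) →
       u ∶ A ∷ Γ ⨾ Δ ⊢ P :: Λ →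
       Γ ⨾ x ∶ ! A ∷ Δ ⊢ P ⟦ x / u ⟧ :: Λ

  ⁇R : Distinct (Γ ++ Δ ++ (x ∶ ⁇ (A ^⊥) ∷ Λ)) →
       u ∶ A ∷ Γ ⨾ Δ ⊢ P :: Λ →
       Γ ⨾ Δ ⊢ P ⟦ x / u ⟧ :: x ∶ ⁇ (A ^⊥) ∷ Λ

  ⁇L : Distinct (Γ ++ (x ∶ ⁇ A ∷ []) ++ []) →
       Γ ⨾ y ∶ A ∷ [] ⊢ P :: [] →
       Γ ⨾ x ∶ ⁇ A ∷ [] ⊢ ‼ x ⦅ y ⦆∙ P :: []

-- P ⊢ᶜ Γ ⨾ Δ, subject to the same conditions on names.
data _⊢ᶜ_⨾_ : Process → Ctx → Ctx → Set where

  exch : Γ ↭ Γ′ → Δ ↭ Δ′ →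
         P ⊢ᶜ Γ ⨾ Δ →
         P ⊢ᶜ Γ′ ⨾ Δ′

  id : Distinct (Γ ++ (x ∶ A ∷ y ∶ A ^⊥ ∷ [])) →
       [ x ↔ y ] ⊢ᶜ Γ ⨾ x ∶ A ∷ y ∶ A ^⊥ ∷ []

  cut : Distinct (Γ ++ (Δ ++ Δ′)) →
        P ⊢ᶜ Γ ⨾ x ∶ A ∷ Δ →
        Q ⊢ᶜ Γ ⨾ x ∶ A ^⊥ ∷ Δ′ →
        ⦅ν x ⦆ (P ∣ Q) ⊢ᶜ Γ ⨾ Δ ++ Δ′

  cut! : Distinct (Γ ++ Δ) →
         P ⊢ᶜ Γ ⨾ y ∶ A ∷ [] →
         Q ⊢ᶜ u ∶ A ^⊥ ∷ Γ ⨾ Δ →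
         ⦅ν u ⦆ ((‼ u ⦅ y ⦆∙ P) ∣ Q) ⊢ᶜ Γ ⨾ Δ

  copy : Distinct ((u ∶ A ∷ Γ) ++ Δ) →
         P ⊢ᶜ u ∶ A ∷ Γ ⨾ y ∶ A ∷ Δ →
         ⦅ν y ⦆ (u ⟨ y ⟩∙ P) ⊢ᶜ u ∶ A ∷ Γ ⨾ Δ

  𝟏I : Distinct (Γ ++ (x ∶ 𝟏 ∷ [])) →
       x ⟨⟩∙𝟎 ⊢ᶜ Γ ⨾ x ∶ 𝟏 ∷ []

  ⊥I : Distinct (Γ ++ (x ∶ ⊥ ∷ Δ)) →
       P ⊢ᶜ Γ ⨾ Δ →
       x ⦅⦆∙ P ⊢ᶜ Γ ⨾ x ∶ ⊥ ∷ Δ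

  ⊗I : Distinct (Γ ++ (x ∶ A ⊗ B ∷ Δ ++ Δ′)) →
       y ∉ dom (Γ ++ (x ∶ A ⊗ B ∷ Δ ++ Δ′)) →
       P ⊢ᶜ Γ ⨾ y ∶ A ∷ Δ →
       Q ⊢ᶜ Γ ⨾ x ∶ B ∷ Δ′ →
       ⦅ν y ⦆ (x ⟨ y ⟩∙ (P ∣ Q)) ⊢ᶜ Γ ⨾ x ∶ A ⊗ B ∷ Δ ++ Δ′

  ⅋I : Distinct (Γ ++ (x ∶ A ⅋ B ∷ Δ)) →
       P ⊢ᶜ Γ ⨾ y ∶ A ∷ x ∶ B ∷ Δ →
       x ⦅ y ⦆∙ P ⊢ᶜ Γ ⨾ x ∶ A ⅋ B ∷ Δ

  !I : Distinct (Γ ++ (x ∶ ! A ∷ [])) →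
       P ⊢ᶜ Γ ⨾ y ∶ A ∷ [] →
       ‼ x ⦅ y ⦆∙ P ⊢ᶜ Γ ⨾ x ∶ ! A ∷ []

  ⁇I : Distinct (Γ ++ (x ∶ ⁇ A ∷ Δ)) →
       P ⊢ᶜ u ∶ A ∷ Γ ⨾ Δ →
       P ⟦ x / u ⟧ ⊢ᶜ Γ ⨾ x ∶ ⁇ A ∷ Δ

𝔘 : Pred Process 0ℓ
𝔘 P = ∃[ Γ ] ∃[ Δ ] ∃[ Λ ] (Γ ⨾ Δ ⊢ P :: Λ)

ℭ : Pred Process 0ℓ
ℭ P = ∃[ Γ ] ∃[ Δ ] (P ⊢ᶜ Γ ⨾ Δ)

-- Read a sequent Γ ⨾ Δ ⊢ P :: Λ one-sidedly as P ⊢ᶜ Γ ^⊥ ⨾ Δ ^⊥ , Λ : each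
-- two-sided rule becomes a one-sided one, the left and right rules of dual
-- connectives being identified.  Conversely P ⊢ᶜ Γ ⨾ Δ is read as
-- Γ ^⊥ ⨾ Δ ^⊥ ⊢ P :: · , which only uses the rules acting on the left zone.
module Submission where

open import Algebra.Properties.CommutativeSemigroup using (interchange)
open import Data.List using (List; []; _∷_; _++_; map)
open import Data.List.Membership.Propositional using (_∉_)
open import Data.List.Properties using (map-++; map-∘; ++-identityʳ)
open import Data.List.Relation.Binary.Permutation.Propositional
  using (_↭_; ↭-refl; ↭-sym; ↭-trans; ↭-reflexive; ↭⇒↭ₛ; prep)
open import Data.List.Relation.Binary.Permutation.Propositional.Properties
  using (map⁺; ++⁺ˡ; ++⁺ʳ; ∈-resp-↭; ++-commutativeMonoid)
  renaming (shift to ↭-shift)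
open import Data.List.Relation.Unary.Unique.Propositional using (Unique)
open import Data.Product using (_,_)
open import Function using (_∘_)
open import Relation.Binary.PropositionalEquality
open import Relation.Unary using (_≐_)
import Algebra.Bundles
import Data.List.Relation.Binary.Permutation.Setoid.Properties as ↭ₛ

open import Defs

private variable
  Γ Δ Δ′ Λ Λ′ Θ : Ctx
  P             : Process
  y             : Name

^⊥-involutive : ∀ A → A ^⊥ ^⊥ ≡ A
^⊥-involutive 𝟏       = refl
^⊥-involutive ⊥       = refl
^⊥-involutive (A ⊗ B) = cong₂ _⊗_ (^⊥-involutive A) (^⊥-involutive B)
^⊥-involutive (A ⅋ B) = cong₂ _⅋_ (^⊥-involutive A) (^⊥-involutive B)
^⊥-involutive (! A)   = cong !_ (^⊥-involutive A)
^⊥-involutive (⁇ A)   = cong ⁇_ (^⊥-involutive A)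

infix 9 _^⊥ᶜ

_^⊥ᶜ : Ctx → Ctx
_^⊥ᶜ = map (λ a → name a ∶ type a ^⊥)

dom-^⊥ᶜ : ∀ Γ → dom (Γ ^⊥ᶜ) ≡ dom Γ
dom-^⊥ᶜ Γ = sym (map-∘ Γ)

^⊥ᶜ-++ : ∀ Γ Δ → (Γ ++ Δ) ^⊥ᶜ ≡ Γ ^⊥ᶜ ++ Δ ^⊥ᶜ
^⊥ᶜ-++ = map-++ _

dom-++-cong : ∀ Γ Γ′ {Δ Δ′} → dom Γ ≡ dom Γ′ → dom Δ ≡ dom Δ′ →
              dom (Γ ++ Δ) ≡ dom (Γ′ ++ Δ′)
dom-++-cong Γ Γ′ {Δ} {Δ′} p q =
  trans (map-++ name Γ Δ) (trans (cong₂ _++_ p q) (sym (map-++ name Γ′ Δ′)))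

Unique-resp-↭ : ∀ {xs ys : List Name} → xs ↭ ys → Unique xs → Unique ys
Unique-resp-↭ p = ↭ₛ.Unique-resp-↭ (setoid Name) (↭⇒↭ₛ p)

infix 6 _▹_

-- The linear zone of the one-sided reading. With the dualised left zone in front, the head of a
-- left zone stays at the head definitionally; only formulas of the right zone have to be moved.
_▹_ : Ctx → Ctx → Ctx
Δ ▹ Λ = Δ ^⊥ᶜ ++ Λ

-- For the rules with two linear premises: a one-sided rule joins the readings of its premises, a
-- two-sided one joins left zones and right zones separately. The two differ by the middle-four
-- interchange of a commutative monoid.
▹-++ : ∀ Δ Δ′ Λ Λ′ →
       (Δ ▹ Λ) ++ (Δ′ ▹ Λ′) ↭ (Δ ++ Δ′) ▹ (Λ ++ Λ′)
▹-++ Δ Δ′ Λ Λ′ = ↭-trans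
  (interchange ++-commutativeSemigroup (Δ ^⊥ᶜ) Λ (Δ′ ^⊥ᶜ) Λ′)
  (↭-reflexive (cong (_++ (Λ ++ Λ′)) (sym (^⊥ᶜ-++ Δ Δ′))))
  where
  open Algebra.Bundles.CommutativeMonoid (++-commutativeMonoid {A = Assignment})
    using () renaming (commutativeSemigroup to ++-commutativeSemigroup)

▹-∷ : ∀ Δ {a Λ} → Δ ▹ (a ∷ Λ) ↭ a ∷ (Δ ▹ Λ)
▹-∷ Δ = ↭-shift _ (Δ ^⊥ᶜ) _

-- Dualising changes types but no names, so distinctness and freshness carry over up to order. `Θ`
-- is the linear zone in the order in which the one-sided rule produces it, before the final
-- exchange.
dom-▹ : ∀ Γ Δ Λ → Θ ↭ Δ ▹ Λ → dom (Γ ++ Δ ++ Λ) ↭ dom (Γ ^⊥ᶜ ++ Θ)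
dom-▹ Γ Δ Λ p = ↭-trans
  (↭-reflexive (sym (dom-++-cong (Γ ^⊥ᶜ) Γ (dom-^⊥ᶜ Γ)
                      (dom-++-cong (Δ ^⊥ᶜ) Δ (dom-^⊥ᶜ Δ) refl))))
  (map⁺ name (++⁺ˡ (Γ ^⊥ᶜ) (↭-sym p)))

distinct-▹ : ∀ Γ Δ Λ → Θ ↭ Δ ▹ Λ →
             Distinct (Γ ++ Δ ++ Λ) → Distinct (Γ ^⊥ᶜ ++ Θ)
distinct-▹ Γ Δ Λ p = Unique-resp-↭ (dom-▹ Γ Δ Λ p)

fresh-▹ : ∀ Γ Δ Λ → Θ ↭ Δ ▹ Λ →
          y ∉ dom (Γ ++ Δ ++ Λ) → y ∉ dom (Γ ^⊥ᶜ ++ Θ)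
fresh-▹ Γ Δ Λ p y∉ = y∉ ∘ ∈-resp-↭ (↭-sym (dom-▹ Γ Δ Λ p))

exchᶜ : Δ ↭ Δ′ → P ⊢ᶜ Γ ⨾ Δ → P ⊢ᶜ Γ ⨾ Δ′
exchᶜ = exch ↭-refl

one-sided : Γ ⨾ Δ ⊢ P :: Λ → P ⊢ᶜ Γ ^⊥ᶜ ⨾ Δ ▹ Λ
one-sided (exch {Δ = Δ} {Λ′ = Λ′} p q r D) =
  exch (map⁺ _ p) (↭-trans (++⁺ˡ (Δ ^⊥ᶜ) r) (++⁺ʳ Λ′ (map⁺ _ q))) (one-sided D)
one-sided (idR {Γ} {x} {A} {y} d) =
  -- `id` is used at `A ^⊥`, so it gives `y` the double dual of `A`.
  subst (λ B → [ x ↔ y ] ⊢ᶜ Γ ^⊥ᶜ ⨾ x ∶ A ^⊥ ∷ y ∶ B ∷ []) (^⊥-involutive A)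
    (id (distinct-▹ Γ (x ∶ A ∷ []) (y ∶ A ∷ []) eq d))
  where
  eq : x ∶ A ^⊥ ∷ y ∶ A ^⊥ ^⊥ ∷ [] ↭ (x ∶ A ∷ []) ▹ (y ∶ A ∷ [])
  eq = ↭-reflexive (cong (λ B → x ∶ A ^⊥ ∷ y ∶ B ∷ []) (^⊥-involutive A))
one-sided (idL {Γ} {x} {A} {y} d) =
  id (distinct-▹ Γ (x ∶ A ∷ y ∶ A ^⊥ ∷ []) [] ↭-refl d)
one-sided (cutR {Γ} {Δ} {Δ′} {Λ} {Λ′} d D E) =
  exchᶜ p (cut (distinct-▹ Γ (Δ ++ Δ′) (Λ ++ Λ′) p d)
    (exchᶜ (▹-∷ Δ) (one-sided D)) (one-sided E))
  where p = ▹-++ Δ Δ′ Λ Λ′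
one-sided (cutL {Γ} {Δ} {Δ′} {Λ} {Λ′} d D E) =
  -- The cut formula is now `A ^⊥`: reading the second premise one-sidedly gives `x` the type
  -- `A ^⊥ ^⊥`, its dual on the nose.
  exchᶜ p (cut (distinct-▹ Γ (Δ ++ Δ′) (Λ ++ Λ′) p d) (one-sided D) (one-sided E))
  where p = ▹-++ Δ Δ′ Λ Λ′
one-sided (cut!R {Γ} {Δ} {Λ} d D E) =
  cut! (distinct-▹ Γ Δ Λ ↭-refl d) (one-sided D) (one-sided E)
one-sided (cut!L {Γ} {Δ} {Λ} {y} {A} {P} d D E) =
  cut! (distinct-▹ Γ Δ Λ ↭-refl d)
    (subst (λ B → P ⊢ᶜ Γ ^⊥ᶜ ⨾ y ∶ B ∷ []) (^⊥-involutive A) (one-sided D)) (one-sided E)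
one-sided (copyL {u} {A} {Γ} {Δ} {Λ} d D) =
  copy (distinct-▹ (u ∶ A ∷ Γ) Δ Λ ↭-refl d) (one-sided D)
one-sided (copyR {u} {A} {Γ} {Δ} {Λ} d D) =
  -- The unrestricted `u ∶ A` has become `u ∶ A ^⊥`, the type that `y` already has on the right.
  copy (distinct-▹ (u ∶ A ∷ Γ) Δ Λ ↭-refl d) (exchᶜ (▹-∷ Δ) (one-sided D))
one-sided (𝟏R {Γ} d) = 𝟏I (distinct-▹ Γ [] _ ↭-refl d)
one-sided (𝟏L {Γ} {x} {Δ} {Λ} d D) =
  ⊥I (distinct-▹ Γ (x ∶ 𝟏 ∷ Δ) Λ ↭-refl d) (one-sided D)
one-sided (⊥R {Γ} {Δ} {x} {Λ} d D) =
  exchᶜ p (⊥I (distinct-▹ Γ Δ (x ∶ ⊥ ∷ Λ) p d) (one-sided D))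
  where p = ↭-sym (▹-∷ Δ)
one-sided (⊥L {Γ} {x} d) = 𝟏I (distinct-▹ Γ (x ∶ ⊥ ∷ []) [] ↭-refl d)
one-sided (⊗R {Γ} {Δ} {Δ′} {x} {A} {B} {Λ} {Λ′} d f D E) =
  exchᶜ p (⊗I (distinct-▹ Γ (Δ ++ Δ′) (_ ∷ Λ ++ Λ′) p d)
              (fresh-▹ Γ (Δ ++ Δ′) (_ ∷ Λ ++ Λ′) p f)
    (exchᶜ (▹-∷ Δ) (one-sided D)) (exchᶜ (▹-∷ Δ′) (one-sided E)))
  where
  p : x ∶ A ⊗ B ∷ (Δ ▹ Λ) ++ (Δ′ ▹ Λ′) ↭ (Δ ++ Δ′) ▹ (x ∶ A ⊗ B ∷ Λ ++ Λ′)
  p = ↭-trans (prep _ (▹-++ Δ Δ′ Λ Λ′)) (↭-sym (▹-∷ (Δ ++ Δ′)))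
one-sided (⊗L {Γ} {x} {A} {B} {Δ} {Λ} d D) =
  ⅋I (distinct-▹ Γ (x ∶ A ⊗ B ∷ Δ) Λ ↭-refl d) (one-sided D)
one-sided (⅋R {Γ} {Δ} {x} {A} {B} {Λ} d D) =
  exchᶜ p (⅋I (distinct-▹ Γ Δ (x ∶ A ⅋ B ∷ Λ) p d)
    (exchᶜ (↭-trans (▹-∷ Δ) (prep _ (▹-∷ Δ))) (one-sided D)))
  where p = ↭-sym (▹-∷ Δ)
one-sided (⅋L {Γ} {x} {A} {B} {Δ} {Δ′} {Λ} {Λ′} d f D E) =
  exchᶜ p (⊗I (distinct-▹ Γ (x ∶ A ⅋ B ∷ Δ ++ Δ′) (Λ ++ Λ′) p d)
              (fresh-▹ Γ (x ∶ A ⅋ B ∷ Δ ++ Δ′) (Λ ++ Λ′) p f)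
    (one-sided D) (one-sided E))
  where p = prep _ (▹-++ Δ Δ′ Λ Λ′)
one-sided (⊸R {Γ} {Δ} {x} {A} {B} {Λ} d D) =
  exchᶜ p (⅋I (distinct-▹ Γ Δ (x ∶ A ⊸ B ∷ Λ) p d)
    -- Coming from the left zone, `y` is already in front with type `A ^⊥`; only `x` is moved.
    (exchᶜ (prep _ (▹-∷ Δ)) (one-sided D)))
  where p = ↭-sym (▹-∷ Δ)
one-sided (⊸L {Γ} {x} {A} {B} {Δ} {Δ′} {Λ} {Λ′} {y} {P} d f D E) =
  exchᶜ p (⊗I (distinct-▹ Γ (x ∶ A ⊸ B ∷ Δ ++ Δ′) (Λ ++ Λ′) p d)
              (fresh-▹ Γ (x ∶ A ⊸ B ∷ Δ ++ Δ′) (Λ ++ Λ′) p f)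
    -- The dual of `A ⊸ B` computes to `A ^⊥ ^⊥ ⊗ B ^⊥`, whereas `y` has type `A`.
    (subst (λ C → P ⊢ᶜ Γ ^⊥ᶜ ⨾ y ∶ C ∷ (Δ ▹ Λ)) (sym (^⊥-involutive A))
      (exchᶜ (▹-∷ Δ) (one-sided D)))
    (one-sided E))
  where p = prep _ (▹-++ Δ Δ′ Λ Λ′)
one-sided (!R {Γ} d D) = !I (distinct-▹ Γ [] _ ↭-refl d) (one-sided D)
one-sided (!L {Γ} {x} {A} {Δ} {Λ} d D) =
  ⁇I (distinct-▹ Γ (x ∶ ! A ∷ Δ) Λ ↭-refl d) (one-sided D)
one-sided (⁇R {Γ} {Δ} {x} {A} {Λ} d D) =
  exchᶜ p (⁇I (distinct-▹ Γ Δ (x ∶ ⁇ (A ^⊥) ∷ Λ) p d) (one-sided D))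
  where p = ↭-sym (▹-∷ Δ)
one-sided (⁇L {Γ} {x} {A} d D) =
  !I (distinct-▹ Γ (x ∶ ⁇ A ∷ []) [] ↭-refl d) (one-sided D)

-- The trailing `[]` is the empty right zone. `Θ` allows for rules whose left zone is a
-- concatenation of duals, which equals the dual of the concatenation only propositionally.
dom-left : ∀ Γ Δ → Θ ≡ Δ ^⊥ᶜ → dom (Γ ^⊥ᶜ ++ Θ ++ []) ≡ dom (Γ ++ Δ)
dom-left Γ Δ refl = dom-++-cong (Γ ^⊥ᶜ) Γ (dom-^⊥ᶜ Γ)
  (trans (cong dom (++-identityʳ (Δ ^⊥ᶜ))) (dom-^⊥ᶜ Δ))

distinct-left : ∀ Γ Δ → Θ ≡ Δ ^⊥ᶜ →
                Distinct (Γ ++ Δ) → Distinct (Γ ^⊥ᶜ ++ Θ ++ [])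
distinct-left Γ Δ p = subst Unique (sym (dom-left Γ Δ p))

fresh-left : ∀ Γ Δ → Θ ≡ Δ ^⊥ᶜ →
             y ∉ dom (Γ ++ Δ) → y ∉ dom (Γ ^⊥ᶜ ++ Θ ++ [])
fresh-left {y = y} Γ Δ p = subst (y ∉_) (sym (dom-left Γ Δ p))

two-sided : P ⊢ᶜ Γ ⨾ Δ → Γ ^⊥ᶜ ⨾ Δ ^⊥ᶜ ⊢ P :: []
two-sided (exch p q D) = exch (map⁺ _ p) (map⁺ _ q) ↭-refl (two-sided D)
two-sided (id {Γ} d) = idL (distinct-left Γ _ refl d)
two-sided (cut {Γ} {Δ} {Δ′} {P} {x} {A} {Q} d D E) =
  subst (λ Θ → Γ ^⊥ᶜ ⨾ Θ ⊢ ⦅ν x ⦆ (P ∣ Q) :: []) (sym p)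
    (cutL (distinct-left Γ (Δ ++ Δ′) (sym p) d) (two-sided D) (two-sided E))
  where p = ^⊥ᶜ-++ Δ Δ′
two-sided (cut! {Γ} {Δ} {A = A} {Q} {u} d D E) =
  cut!L (distinct-left Γ Δ refl d) (two-sided D)
    -- The first premise fixes the cut formula of `cut!L` as `A`, but `u` arrives with the double
    -- dual.
    (subst (λ B → u ∶ B ∷ Γ ^⊥ᶜ ⨾ Δ ^⊥ᶜ ⊢ Q :: []) (^⊥-involutive A) (two-sided E))
two-sided (copy {u} {A} {Γ} {Δ} d D) =
  copyL (distinct-left (u ∶ A ∷ Γ) Δ refl d) (two-sided D)
two-sided (𝟏I {Γ} d) = ⊥L (distinct-left Γ _ refl d)
two-sided (⊥I {Γ} d D) = 𝟏L (distinct-left Γ _ refl d) (two-sided D)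
two-sided (⊗I {Γ} {x} {A} {B} {Δ} {Δ′} {y} {P} {Q} d f D E) =
  subst (λ Θ → Γ ^⊥ᶜ ⨾ Θ ⊢ ⦅ν y ⦆ (x ⟨ y ⟩∙ (P ∣ Q)) :: []) (sym p)
    (⅋L (distinct-left Γ (x ∶ A ⊗ B ∷ Δ ++ Δ′) (sym p) d)
        (fresh-left Γ (x ∶ A ⊗ B ∷ Δ ++ Δ′) (sym p) f)
      (two-sided D) (two-sided E))
  where p = cong (x ∶ (A ⊗ B) ^⊥ ∷_) (^⊥ᶜ-++ Δ Δ′)
two-sided (⅋I {Γ} d D) = ⊗L (distinct-left Γ _ refl d) (two-sided D)
two-sided (!I {Γ} d D) = ⁇L (distinct-left Γ _ refl d) (two-sided D)
two-sided (⁇I {Γ} d D) = !L (distinct-left Γ _ refl d) (two-sided D)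

theorem3p2 : 𝔘 ≐ ℭ
theorem3p2 = (λ (_ , _ , _ , D) → _ , _ , one-sided D)
           , (λ (_ , _ , D) → _ , _ , _ , two-sided D)
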